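{- Let $D$ be a finite simply-laced tree that contains the Dynkin diagram $\mathbf{E}_6$ as a subgraph; that is, $D$ has a vertex $v$ of degree at least $3$ such that at least two of the connected components of $D\setminus\{v\}$ (the arms at $v$) contain at least two vertices each. Then, apart from the fixed labelings (each of which forms a class by itself), the labelings of $D$ form exactly two equivalence classes: the class of all non-fixed labelings with an odd number of components, and the class of all non-fixed labelings with an even number of components.
   Context: Reeder's puzzle on a finite connected simple graph $D$: a labeling is a vector $a=(a_i)$ with $a_i\in\mathbb{Z}/2\mathbb{Z}$ for each vertex $i$. For a vertex $i$, the move $T_i$ sends $a$ to $a'$ with $a'_j=a_j$ for $j\neq i$ and $a'_i=a_i+\sum_k a_k \pmod 2$, the sum over all neighbors $k$ of $i$. Two labelings are equivalent if one can be obtained from the other by a finite sequence of moves. A labeling is fixed if $T_i(a)=a$ for every vertex $i$. The components of a labeling are the connected components of the subgraph induced on the set of vertices labeled $1$. -}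

module Defs where

open import Data.Nat using (ℕ; _≤_; _%_)
open import Data.Fin using (Fin)
open import Data.Bool using (Bool; true; false; _∧_; _xor_)
open import Data.List as List using (List; []; _∷_; _++_; [_]; length)
open import Data.List.Relation.Unary.Unique.Propositional using (Unique)
open import Data.Vec using (Vec; lookup; updateAt)
open import Data.Product using (Σ; ∃; ∃-syntax; _×_; _,_)
open import Data.Unit using (⊤)
open import Relation.Nullary using (¬_)
open import Relation.Binary.PropositionalEquality using (_≡_; _≢_)
open import Relation.Binary.Construct.Closure.ReflexiveTransitive using (Star)
open import Function.Bundles using (_⇔_)

record SimpleGraph (n : ℕ) : Set where
  field
    adj     : Fin n → Fin n → Bool
    adj-sym : ∀ i j → adj i j ≡ adj j i
    irrefl  : ∀ i → adj i i ≡ false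

module _ {n : ℕ} (G : SimpleGraph n) where
  open SimpleGraph G

  Adj : Fin n → Fin n → Set
  Adj i j = adj i j ≡ true

  data WalkIn (P : Fin n → Set) : Fin n → Fin n → Set where
    here : ∀ {i} → P i → WalkIn P i i
    step : ∀ {i j k} → P i → Adj i j → WalkIn P j k → WalkIn P i k

  AnyVertex : Fin n → Set
  AnyVertex _ = ⊤

  Connected : Set
  Connected = ∀ i j → WalkIn AnyVertex i j

  IsWalkList : List (Fin n) → Set
  IsWalkList []            = ⊤
  IsWalkList (x ∷ [])      = ⊤
  IsWalkList (x ∷ y ∷ xs)  = Adj x y × IsWalkList (y ∷ xs)

  HasCycle : Set
  HasCycle = Σ (Fin n) λ x → Σ (List (Fin n)) λ xs →
    (2 ≤ length xs) × Unique (x ∷ xs) × IsWalkList (x ∷ xs ++ [ x ])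

  IsTree : Set
  IsTree = Connected × ¬ HasCycle

  Avoid : Fin n → Fin n → Set
  Avoid v w = w ≢ v

  ContainsE6 : Set
  ContainsE6 = Σ (Fin n) λ v →
    (Σ (Fin n) λ u₁ → Σ (Fin n) λ u₂ → Σ (Fin n) λ u₃ →
       Adj v u₁ × Adj v u₂ × Adj v u₃ × u₁ ≢ u₂ × u₁ ≢ u₃ × u₂ ≢ u₃)
    × (Σ (Fin n) λ x₁ → Σ (Fin n) λ y₁ → Σ (Fin n) λ x₂ → Σ (Fin n) λ y₂ →
         x₁ ≢ y₁ × x₂ ≢ y₂
         × WalkIn (Avoid v) x₁ y₁ × WalkIn (Avoid v) x₂ y₂
         × ¬ WalkIn (Avoid v) x₁ x₂)

  -- labelings with values in ℤ/2ℤ ≅ Bool (xor = addition)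
  Labeling : Set
  Labeling = Vec Bool n

  nbrSum : Labeling → Fin n → Bool
  nbrSum a i = List.foldr _xor_ false (List.map (λ k → adj i k ∧ lookup a k) (List.allFin n))

  T : Fin n → Labeling → Labeling
  T i a = updateAt a i (λ x → x xor nbrSum a i)

  Move : Labeling → Labeling → Set
  Move a b = ∃[ i ] T i a ≡ b

  _∼_ : Labeling → Labeling → Set
  a ∼ b = Star Move a b

  Fixed : Labeling → Set
  Fixed a = ∀ i → T i a ≡ a

  On : Labeling → Fin n → Set
  On a i = lookup a i ≡ true

  -- "a has exactly k components": the components of the subgraph induced on the
  -- vertices labelled 1 are in bijection with Fin k, via c.
  HasComponents : Labeling → ℕ → Set
  HasComponents a k = Σ ((i : Fin n) → On a i → Fin k) λ c →
    (∀ m → Σ (Fin n) λ i → Σ (On a i) λ p → c i p ≡ m)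
    × (∀ i j (p : On a i) (q : On a j) → (c i p ≡ c j q) ⇔ WalkIn (On a) i j)

{-# OPTIONS --safe #-}
-- Write q(a) ∈ ℤ/2 for the number of labelled vertices plus the number of edges between them. Moves
-- preserve q, and on a forest q counts components modulo 2. It remains to join any two non-fixed
-- labelings with the same q. Fix the six vertices W of a copy of E₆, and note that the moves at W act
-- on the vector of neighbour sums at W by themselves, whatever the labels elsewhere. A
-- non-fixed labeling can be brought to a state where this vector is nonzero. Then, for every vertex
-- p outside W, the label at p can be changed without touching the vertices farther out and keeping
-- the vector nonzero: if p is attached to W, this is a finite check on E₆; otherwise, toggle the
-- parent of p first if T_p does not move. So all labels outside W can be erased from the outermost
-- inwards, and a second finite check on E₆ brings the rest to one of two labelings, told apart by q.
module Submission where

open import Defs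
open import Data.Bool using (Bool; true; false; not; _∧_; _xor_; if_then_else_)
import Data.Bool.Properties as Bool
open import Data.Fin using (Fin; zero; suc; _≟_; _<_; punchIn; punchOut)
open import Data.Fin.Patterns
open import Data.Fin.Properties
  using (all?; any?; ¬∀⟶∃¬; <-cmp; punchInᵢ≢i; punchOut-punchIn; punchOut-injective; punchOut-cong)
open import Data.List as List using (List; []; _∷_; _++_; [_]; allFin; length)
import Data.List.Membership.DecPropositional as DecMembership
open import Data.List.Membership.Propositional using (_∈_; _∉_)
open import Data.List.Membership.Propositional.Properties using (∈-allFin; ∈-map⁺; ∈-map⁻)
open import Data.List.Properties using (map-∘; map-cong)
open import Data.List.Relation.Unary.All as All using (All; []; _∷_)
open import Data.List.Relation.Unary.All.Properties using (All¬⇒¬Any; ++⁺)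
open import Data.List.Relation.Unary.AllPairs using ([]; _∷_)
open import Data.List.Relation.Unary.Any using (here; there)
open import Data.List.Relation.Unary.Unique.Propositional using (Unique)
import Data.List.Relation.Unary.Unique.Propositional.Properties as Unique
open import Data.Nat using (ℕ; zero; suc; _%_; _≤_; s≤s; z≤n)
open import Data.Product using (Σ; ∃; _×_; _,_; proj₁; proj₂)
open import Data.Sum using (_⊎_; inj₁; inj₂)
open import Data.Unit using (tt)
open import Data.Vec using (Vec; []; _∷_; lookup; tabulate; updateAt; replicate)
open import Data.Vec.Properties
  using (≡-dec; lookup∘tabulate; tabulate-cong; lookup-replicate; lookup∘updateAt; lookup∘updateAt′;
         updateAt-cong; updateAt-id; updateAt-updateAt)
open import Function.Base using (_∘_; id; case_of_)
open import Function.Bundles using (_⇔_; mk⇔; Equivalence)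
open import Relation.Binary.Construct.Closure.ReflexiveTransitive using (ε; _◅_; _◅◅_; reverse)
open import Relation.Binary.Definitions using (tri<; tri≈; tri>)
open import Relation.Binary.PropositionalEquality
  using (_≡_; _≢_; refl; sym; trans; cong; cong₂; subst; module ≡-Reasoning)
open import Relation.Nullary using (¬_; Dec; yes; no; contradiction)
open import Relation.Nullary.Decidable
  using (from-yes; toWitness; map′; _→-dec_; _×-dec_; _⊎-dec_; ⌊_⌋)
open import Relation.Unary using (Decidable)

-- Bits, parity, flips and supports

∀Bool? : {P : Bool → Set} → Decidable P → Dec (∀ b → P b)
∀Bool? P? = map′ (λ { (f , t) false → f ; (f , t) true → t }) (λ p → p false , p true)
  (P? false ×-dec P? true)

-- Enumerating all vectors makes the checks on E₆ below decidable, so that evaluation proves them.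
∀Vec? : ∀ {n} {P : Vec Bool n → Set} → Decidable P → Dec (∀ v → P v)
∀Vec? {zero}  P? = map′ (λ { p [] → p }) (λ p → p []) (P? [])
∀Vec? {suc n} P? = map′ (λ { p (b ∷ v) → p b v }) (λ p b v → p (b ∷ v))
  (∀Bool? λ b → ∀Vec? λ v → P? (b ∷ v))

≢true⇒≡false : ∀ {b} → b ≢ true → b ≡ false
≢true⇒≡false {false} _ = refl
≢true⇒≡false {true}  h = contradiction refl h

odd : ℕ → Bool
odd zero    = false
odd (suc k) = not (odd k)

bit : Bool → ℕ
bit b = if b then 1 else 0

bit-injective : ∀ {b c} → bit b ≡ bit c → b ≡ c
bit-injective {false} {false} _ = refl
bit-injective {true}  {true}  _ = refl

%2-odd : ∀ k → k % 2 ≡ bit (odd k)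
%2-odd zero          = refl
%2-odd (suc zero)    = refl
%2-odd (suc (suc k)) = trans (%2-odd k) (cong bit (sym (Bool.not-involutive _)))

lookup-ext : ∀ {m} {v w : Vec Bool m} → (∀ k → lookup v k ≡ lookup w k) → v ≡ w
lookup-ext {v = []}    {[]}    h = refl
lookup-ext {v = _ ∷ _} {_ ∷ _} h = cong₂ _∷_ (h zero) (lookup-ext (h ∘ suc))

flip : ∀ {n} → Fin n → Vec Bool n → Vec Bool n
flip i a = updateAt a i not

lookup-flip : ∀ {n} (i : Fin n) a → lookup (flip i a) i ≡ not (lookup a i)
lookup-flip i a = lookup∘updateAt i a

lookup-flip-≢ : ∀ {n} {i j : Fin n} → j ≢ i → ∀ a → lookup (flip i a) j ≡ lookup a j
lookup-flip-≢ {i = i} {j} j≢i a = lookup∘updateAt′ j i j≢i a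

SupportedOn : ∀ {n} → List (Fin n) → Vec Bool n → Set
SupportedOn S a = ∀ i → lookup a i ≡ true → i ∈ S

AgreeOff : ∀ {n} → List (Fin n) → Vec Bool n → Vec Bool n → Set
AgreeOff S a b = ∀ i → i ∉ S → lookup b i ≡ lookup a i

agreeOff-supported : ∀ {n} {S : List (Fin n)} a b → AgreeOff S a b → SupportedOn S a → SupportedOn S b
agreeOff-supported {S = S} a b off supp s on with DecMembership._∈?_ _≟_ s S
... | yes s∈ = s∈
... | no s∉  = supp s (trans (sym (off s s∉)) on)

supported-shrink : ∀ {n} {ℓ : Fin n} {S} a → SupportedOn (ℓ ∷ S) a → lookup a ℓ ≡ false → SupportedOn S a
supported-shrink a supp off i on with supp i on
... | here refl = case trans (sym on) off of λ ()
... | there i∈S = i∈S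

supported-flip : ∀ {n} {ℓ : Fin n} {S} a → SupportedOn (ℓ ∷ S) a → lookup a ℓ ≡ true → SupportedOn S (flip ℓ a)
supported-flip {ℓ = ℓ} {S} a supp on = supported-shrink (flip ℓ a) supp′ (trans (lookup-flip ℓ a) (cong not on))
  where
  supp′ : SupportedOn (ℓ ∷ S) (flip ℓ a)
  supp′ i p with i ≟ ℓ
  ... | yes refl = here refl
  ... | no i≢ℓ   = supp i (trans (sym (lookup-flip-≢ i≢ℓ a)) p)

-- Neighbour sums and the quadratic form

module _ {n : ℕ} (G : SimpleGraph n) where
  open SimpleGraph G

  adj⇒≢ : ∀ {s t} → Adj G s t → s ≢ t
  adj⇒≢ {s} e refl = case trans (sym e) (irrefl s) of λ ()

  -- `nbrSum` with the vertex list as a parameter, for induction on that list; `nbrSum` is the case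
  -- `allFin n`.
  sumOver : List (Fin n) → Labeling G → Fin n → Bool
  sumOver L a i = List.foldr _xor_ false (List.map (λ k → adj i k ∧ lookup a k) L)

  sumOver-cong : ∀ L a b i → (∀ {k} → k ∈ L → Adj G i k → lookup a k ≡ lookup b k) →
    sumOver L a i ≡ sumOver L b i
  sumOver-cong []      a b i h = refl
  sumOver-cong (k ∷ L) a b i h with adj i k in e
  ... | true  = cong₂ _xor_ (h (here refl) e) (sumOver-cong L a b i (h ∘ there))
  ... | false = sumOver-cong L a b i (h ∘ there)

  sumOver-flip-∉ : ∀ {L j} → j ∉ L → ∀ a i → sumOver L (flip j a) i ≡ sumOver L a i
  sumOver-flip-∉ {L} {j} j∉L a i =
    sumOver-cong L (flip j a) a i λ k∈L _ → lookup-flip-≢ (λ { refl → j∉L k∈L }) a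

  sumOver-flip : ∀ {L j} → Unique L → j ∈ L → ∀ a i → sumOver L (flip j a) i ≡ sumOver L a i xor adj i j
  sumOver-flip {k ∷ L} {j} (k∉L ∷ _) (here refl) a i
    rewrite lookup-flip k a | sumOver-flip-∉ (All¬⇒¬Any k∉L) a i = identity (adj i k) (lookup a k) _
    where
    identity : ∀ e x s → (e ∧ not x) xor s ≡ ((e ∧ x) xor s) xor e
    identity = toWitness {a? = ∀Bool? λ e → ∀Bool? λ x → ∀Bool? λ s → _ Bool.≟ _} _
  sumOver-flip {k ∷ L} {j} (k∉L ∷ u) (there j∈L) a i
    rewrite lookup-flip-≢ {i = j} {k} (λ { refl → All¬⇒¬Any k∉L j∈L }) a | sumOver-flip u j∈L a i =
    sym (Bool.xor-assoc (adj i k ∧ lookup a k) (sumOver L a i) (adj i j))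

  -- Labelled vertices plus edges between them modulo 2, each edge counted at its endpoint listed first.
  quad : List (Fin n) → Labeling G → Bool
  quad []      a = false
  quad (k ∷ L) a = (lookup a k ∧ not (sumOver L a k)) xor quad L a

  quad-flip-∉ : ∀ {L j} → j ∉ L → ∀ a → quad L (flip j a) ≡ quad L a
  quad-flip-∉ {[]}    _   a = refl
  quad-flip-∉ {k ∷ L} {j} j∉L a
    rewrite lookup-flip-≢ {i = j} {k} (λ { refl → j∉L (here refl) }) a
          | sumOver-flip-∉ (j∉L ∘ there) a k | quad-flip-∉ (j∉L ∘ there) a = refl

  -- `quad` is a quadratic form over ℤ/2 that takes the value 1 on a single vertex and has adjacency
  -- as its polar form. So adding the vertex `j` contributes 1 plus the neighbour sum at `j`.
  quad-flip : ∀ {L j} → Unique L → j ∈ L → ∀ a → quad L (flip j a) ≡ not (quad L a xor sumOver L a j)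
  quad-flip {k ∷ L} (k∉L ∷ _) (here refl) a
    rewrite lookup-flip k a | sumOver-flip-∉ (All¬⇒¬Any k∉L) a k | quad-flip-∉ (All¬⇒¬Any k∉L) a | irrefl k =
    identity (lookup a k) (sumOver L a k) (quad L a)
    where
    identity : ∀ x s q → (not x ∧ not s) xor q ≡ not (((x ∧ not s) xor q) xor s)
    identity = toWitness {a? = ∀Bool? λ x → ∀Bool? λ s → ∀Bool? λ q → _ Bool.≟ _} _
  quad-flip {k ∷ L} {j} (k∉L ∷ u) (there j∈L) a
    rewrite lookup-flip-≢ {i = j} {k} (λ { refl → All¬⇒¬Any k∉L j∈L }) a | sumOver-flip u j∈L a k
          | quad-flip u j∈L a | adj-sym j k =
    identity (lookup a k) (sumOver L a k) (adj k j) (quad L a) (sumOver L a j)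
    where
    identity : ∀ x s e q t →
      (x ∧ not (s xor e)) xor not (q xor t) ≡ not (((x ∧ not s) xor q) xor ((e ∧ x) xor t))
    identity = toWitness {a? = ∀Bool? λ x → ∀Bool? λ s → ∀Bool? λ e → ∀Bool? λ q → ∀Bool? λ t → _ Bool.≟ _} _

  nbrSum-flip : ∀ j a i → nbrSum G (flip j a) i ≡ nbrSum G a i xor adj i j
  nbrSum-flip j = sumOver-flip (Unique.allFin⁺ n) (∈-allFin j)

  nbrSum-cong : ∀ a b i → (∀ {k} → Adj G i k → lookup a k ≡ lookup b k) → nbrSum G a i ≡ nbrSum G b i
  nbrSum-cong a b i h = sumOver-cong (allFin n) a b i (λ _ → h)

  sumOver-off : ∀ L a → (∀ i → lookup a i ≡ false) → ∀ i → sumOver L a i ≡ false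
  sumOver-off []      a off i = refl
  sumOver-off (k ∷ L) a off i rewrite off k | Bool.∧-zeroʳ (adj i k) = sumOver-off L a off i

  quad-off : ∀ L a → (∀ i → lookup a i ≡ false) → quad L a ≡ false
  quad-off []      a off = refl
  quad-off (k ∷ L) a off rewrite off k = quad-off L a off

  -- Clearing the labelled vertices of `M` one at a time changes both sums by the same edge, so the
  -- order of `M` never has to be compared with that of `allFin n`.
  nbrSum-supported : ∀ {M} → Unique M → ∀ a → SupportedOn M a → ∀ i → nbrSum G a i ≡ sumOver M a i
  nbrSum-supported {[]}    _         a supp i =
    sumOver-off (allFin n) a (λ j → ≢true⇒≡false λ on → case supp j on of λ ()) i
  nbrSum-supported {k ∷ M} (k∉M ∷ u) a supp i with lookup a k in e
  ... | false rewrite Bool.∧-zeroʳ (adj i k) = nbrSum-supported u a (supported-shrink a supp e) i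
  ... | true  = begin
    nbrSum G a i                                    ≡⟨ identity (nbrSum G a i) (adj i k) ⟩
    (adj i k ∧ true) xor (nbrSum G a i xor adj i k) ≡⟨ cong ((adj i k ∧ true) xor_) (nbrSum-flip k a i) ⟨
    (adj i k ∧ true) xor nbrSum G (flip k a) i      ≡⟨ cong ((adj i k ∧ true) xor_) (nbrSum-supported u (flip k a) (supported-flip a supp e) i) ⟩
    (adj i k ∧ true) xor sumOver M (flip k a) i     ≡⟨ cong ((adj i k ∧ true) xor_) (sumOver-flip-∉ (All¬⇒¬Any k∉M) a i) ⟩
    (adj i k ∧ true) xor sumOver M a i              ∎
    where
    open ≡-Reasoning
    identity : ∀ s e → s ≡ (e ∧ true) xor (s xor e)
    identity = toWitness {a? = ∀Bool? λ s → ∀Bool? λ e → _ Bool.≟ _} _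

  -- Moves and the invariance of the form

  T-active : ∀ i a → nbrSum G a i ≡ true → T G i a ≡ flip i a
  T-active i a h = updateAt-cong i (λ x → trans (cong (x xor_) h) (Bool.xor-comm x true)) a

  T-inactive : ∀ i a → nbrSum G a i ≡ false → T G i a ≡ a
  T-inactive i a h =
    trans (updateAt-cong i (λ x → trans (cong (x xor_) h) (Bool.xor-identityʳ x)) a) (updateAt-id i a)

  T-cases : ∀ i a → (nbrSum G a i ≡ true × T G i a ≡ flip i a) ⊎ (nbrSum G a i ≡ false × T G i a ≡ a)
  T-cases i a = cases (nbrSum G a i) refl
    where
    cases : ∀ s → nbrSum G a i ≡ s →
      (nbrSum G a i ≡ true × T G i a ≡ flip i a) ⊎ (nbrSum G a i ≡ false × T G i a ≡ a)
    cases true  h = inj₁ (h , T-active i a h)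
    cases false h = inj₂ (h , T-inactive i a h)

  lookup-T-≢ : ∀ {i j} → j ≢ i → ∀ a → lookup (T G i a) j ≡ lookup a j
  lookup-T-≢ {i} {j} j≢i a = lookup∘updateAt′ j i j≢i a

  lookup-T : ∀ i a → lookup (T G i a) i ≡ lookup a i xor nbrSum G a i
  lookup-T i a = lookup∘updateAt i a

  -- The new sums depend on the old sums and on the graph, not on the labels. This lets moves act on
  -- vectors of neighbour sums.
  nbrSum-T : ∀ i a j → nbrSum G (T G i a) j ≡ nbrSum G a j xor (nbrSum G a i ∧ adj j i)
  nbrSum-T i a j with T-cases i a
  ... | inj₁ (h , eq) rewrite eq | h = nbrSum-flip i a j
  ... | inj₂ (h , eq) rewrite eq | h = sym (Bool.xor-identityʳ _)

  nbrSum-T-self : ∀ i a → nbrSum G (T G i a) i ≡ nbrSum G a i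
  nbrSum-T-self i a rewrite nbrSum-T i a i | irrefl i | Bool.∧-zeroʳ (nbrSum G a i) = Bool.xor-identityʳ _

  q : Labeling G → Bool
  q = quad (allFin n)

  q-flip : ∀ i a → q (flip i a) ≡ not (q a xor nbrSum G a i)
  q-flip i = quad-flip (Unique.allFin⁺ n) (∈-allFin i)

  -- A move that acts has neighbour sum 1 at `i`, which cancels the 1 contributed by the vertex `i`
  -- itself.
  q-T : ∀ i a → q (T G i a) ≡ q a
  q-T i a with T-cases i a
  ... | inj₂ (_ , eq) = cong q eq
  ... | inj₁ (e , eq) = begin
    q (T G i a)                ≡⟨ cong q eq ⟩
    q (flip i a)               ≡⟨ q-flip i a ⟩
    not (q a xor nbrSum G a i) ≡⟨ cong (λ s → not (q a xor s)) e ⟩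
    not (q a xor true)         ≡⟨ cong not (Bool.xor-comm (q a) true) ⟩
    not (not (q a))            ≡⟨ Bool.not-involutive (q a) ⟩
    q a                        ∎
    where open ≡-Reasoning

  q-∼ : ∀ {a b} → _∼_ G a b → q a ≡ q b
  q-∼ ε                       = refl
  q-∼ (_◅_ {a} (i , refl) ms) = trans (sym (q-T i a)) (q-∼ ms)

  move : ∀ i a → _∼_ G a (T G i a)
  move i a = (i , refl) ◅ ε

  T-involutive : ∀ i a → T G i (T G i a) ≡ a
  T-involutive i a with T-cases i a
  ... | inj₂ (_ , eq) = trans (cong (T G i) eq) eq
  ... | inj₁ (e , eq) = trans (T-active i (T G i a) (trans (nbrSum-T-self i a) e))
    (trans (cong (flip i) eq)
      (trans (updateAt-updateAt i a)
        (trans (updateAt-cong i Bool.not-involutive a) (updateAt-id i a))))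

  ∼-sym : ∀ {a b} → _∼_ G a b → _∼_ G b a
  ∼-sym = reverse λ { {a} (i , refl) → i , T-involutive i a }

  -- Growing by leaves, and the parity of the number of components

  -- Each new `ℓ` is a leaf: `p` is its only neighbour in `S`. Grown from one vertex, the list spans
  -- a tree; grown from the core, it orders the remaining vertices outwards. The newest vertex is
  -- the head, so induction strips leaves from the outside.
  data Grown (B : List (Fin n)) : List (Fin n) → Set where
    base : Grown B B
    grow : ∀ {S ℓ p} → Grown B S → p ∈ S → Adj G p ℓ → ℓ ∉ S →
           (∀ {s} → s ∈ S → Adj G s ℓ → s ≡ p) → Grown B (ℓ ∷ S)

  Grown-trans : ∀ {B C S} → Grown B C → Grown C S → Grown B S
  Grown-trans g base              = g
  Grown-trans g (grow h p e ℓ u) = grow (Grown-trans g h) p e ℓ u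

  off-flip-on : ∀ a {ℓ i} → On G (flip ℓ a) i → lookup a ℓ ≡ true → i ≢ ℓ × On G a i
  off-flip-on a {ℓ} {i} on aℓ with i ≟ ℓ
  ... | yes refl = case trans (sym on) (trans (lookup-flip ℓ a) (cong not aℓ)) of λ ()
  ... | no i≢ℓ   = i≢ℓ , trans (sym (lookup-flip-≢ i≢ℓ a)) on

  walk-map : ∀ {P Q : Fin n → Set} → (∀ {i} → P i → Q i) → ∀ {i j} → WalkIn G P i j → WalkIn G Q i j
  walk-map f (here p)     = here (f p)
  walk-map f (step p e w) = step (f p) e (walk-map f w)

  walk-start : ∀ {P : Fin n → Set} {i j} → WalkIn G P i j → P i
  walk-start (here p)     = p
  walk-start (step p _ _) = p

  walk-trans : ∀ {P : Fin n → Set} {i j k} → WalkIn G P i j → WalkIn G P j k → WalkIn G P i k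
  walk-trans (here _)     w = w
  walk-trans (step p e v) w = step p e (walk-trans v w)

  walk-sym : ∀ {P : Fin n → Set} {i j} → WalkIn G P i j → WalkIn G P j i
  walk-sym (here p)             = here p
  walk-sym (step {i} {j} p e w) =
    walk-trans (walk-sym w) (step (walk-start w) (trans (adj-sym j i) e) (here p))

  module _ (a : Labeling G) {ℓ p : Fin n} (leaf : ∀ {s} → On G a s → Adj G s ℓ → s ≡ p) where

    -- A walk that enters the leaf ℓ does so from p and returns to p at once.
    walk-bypass : ∀ {i j} → j ≢ ℓ → WalkIn G (On G a) i j →
      (i ≢ ℓ → WalkIn G (On G (flip ℓ a)) i j) × (i ≡ ℓ → WalkIn G (On G (flip ℓ a)) p j)
    walk-bypass j≢ℓ (here on) = (λ i≢ℓ → here (trans (lookup-flip-≢ i≢ℓ a) on)) , λ i≡ℓ → contradiction i≡ℓ j≢ℓ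
    walk-bypass {i} j≢ℓ (step {j = k} on e w) with walk-bypass j≢ℓ w | k ≟ ℓ
    ... | _ , after | yes refl =
      (λ _ → subst (λ s → WalkIn G (On G (flip ℓ a)) s _) (sym (leaf on e)) (after refl)) ,
      λ { refl → case trans (sym e) (irrefl ℓ) of λ () }
    ... | direct , _ | no k≢ℓ =
      (λ i≢ℓ → step (trans (lookup-flip-≢ i≢ℓ a) on) e (direct k≢ℓ)) ,
      λ { refl → subst (λ s → WalkIn G (On G (flip ℓ a)) s _)
                   (leaf (walk-start w) (trans (adj-sym k ℓ) e)) (direct k≢ℓ) }

  Isolated : Labeling G → Fin n → Set
  Isolated a ℓ = ∀ {s} → On G a s → ¬ Adj G s ℓ

  module _ (a : Labeling G) {ℓ : Fin n} (ℓ-on : On G a ℓ) where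

    private
      restrict : ∀ {i} → On G (flip ℓ a) i → On G a i
      restrict on = proj₂ (off-flip-on a on ℓ-on)

      -≢ℓ : ∀ {i} → On G (flip ℓ a) i → i ≢ ℓ
      -≢ℓ on = proj₁ (off-flip-on a on ℓ-on)

    -- The component of `ℓ` survives because it contains `p`, and walks can bypass the leaf `ℓ`, so
    -- the same indexing `c` still works.
    components-attached : ∀ {p} → On G a p → Adj G p ℓ → (∀ {s} → On G a s → Adj G s ℓ → s ≡ p) →
      ∀ {k} → HasComponents G a k → HasComponents G (flip ℓ a) k
    components-attached {p} p-on pℓ leaf (c , surj , conn) =
      (λ i on → c i (restrict on)) , surj′ ,
      λ i j oi oj → mk⇔
        (λ eq → proj₁ (walk-bypass a leaf (-≢ℓ oj) (Equivalence.to (conn i j _ _) eq)) (-≢ℓ oi))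
        (λ w → Equivalence.from (conn i j _ _) (walk-map restrict w))
      where
      p-on′ : On G (flip ℓ a) p
      p-on′ = trans (lookup-flip-≢ (adj⇒≢ pℓ) a) p-on
      surj′ : ∀ m → Σ (Fin n) λ i → Σ (On G (flip ℓ a) i) λ on → c i (restrict on) ≡ m
      surj′ m with surj m
      ... | i , on , eq with i ≟ ℓ
      -- `c` takes a proof that the vertex is labelled; the trivial walk shows that its value does
      -- not depend on that proof.
      ... | no i≢ℓ   = i , trans (lookup-flip-≢ i≢ℓ a) on ,
        trans (Equivalence.from (conn i i _ _) (here on)) eq
      ... | yes refl = p , p-on′ ,
        trans (Equivalence.from (conn p ℓ _ _) (step p-on pℓ (here on))) eq

    -- `ℓ` is a component by itself, so no other vertex uses its index and `punchOut` can remove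
    -- that index.
    components-isolated : Isolated a ℓ →
      ∀ {k} → HasComponents G a (suc k) → HasComponents G (flip ℓ a) k
    components-isolated iso {k} (c , surj , conn) =
      (λ i on → punchOut (c≢ on)) , surj′ ,
      λ i j oi oj → mk⇔
        (λ eq → proj₁ (walk-bypass a {p = ℓ} (λ on e → contradiction e (iso on)) (-≢ℓ oj)
                  (Equivalence.to (conn i j _ _) (punchOut-injective (c≢ oi) (c≢ oj) eq))) (-≢ℓ oi))
        (λ w → punchOut-cong (c ℓ ℓ-on) (Equivalence.from (conn i j _ _) (walk-map restrict w)))
      where
      stuck : ∀ {i} → WalkIn G (On G a) ℓ i → i ≡ ℓ
      stuck (here _)             = refl
      stuck (step {j = j} _ e w) = contradiction (trans (adj-sym j ℓ) e) (iso (walk-start w))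
      c≢ : ∀ {i} (on : On G (flip ℓ a) i) → c ℓ ℓ-on ≢ c i (restrict on)
      c≢ {i} on eq = -≢ℓ on (stuck (Equivalence.to (conn ℓ i _ _) eq))
      surj′ : ∀ m → Σ (Fin n) λ i → Σ (On G (flip ℓ a) i) λ on → punchOut (c≢ on) ≡ m
      surj′ m with surj (punchIn (c ℓ ℓ-on) m)
      ... | i , on , eq with i ≟ ℓ
      ... | yes refl = contradiction
        (sym (trans (Equivalence.from (conn ℓ ℓ _ _) (here on)) eq)) (punchInᵢ≢i (c ℓ ℓ-on) m)
      ... | no i≢ℓ   = i , trans (lookup-flip-≢ i≢ℓ a) on , trans
        (punchOut-cong (c ℓ ℓ-on) (trans (Equivalence.from (conn i i _ _) (here on)) eq))
        (punchOut-punchIn (c ℓ ℓ-on))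

  nbrSum-isolated : ∀ a {ℓ} → Isolated a ℓ → nbrSum G a ℓ ≡ false
  nbrSum-isolated a {ℓ} iso = trans
    (nbrSum-cong a (replicate n false) ℓ λ {k} ℓk →
      trans (≢true⇒≡false λ on → iso on (trans (adj-sym k ℓ) ℓk)) (sym (lookup-replicate k false)))
    (sumOver-off (allFin n) (replicate n false) (λ i → lookup-replicate i false) ℓ)

  -- Clearing `p` isolates `ℓ`, so the only contribution to the sum is that of `p`.
  nbrSum-leaf : ∀ a {ℓ p} → On G a p → Adj G p ℓ → (∀ {s} → On G a s → Adj G s ℓ → s ≡ p) →
    nbrSum G a ℓ ≡ true
  nbrSum-leaf a {ℓ} {p} on e leaf = begin
    nbrSum G a ℓ                           ≡⟨ identity _ (adj ℓ p) ⟩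
    (nbrSum G a ℓ xor adj ℓ p) xor adj ℓ p ≡⟨ cong₂ _xor_ (sym (nbrSum-flip p a ℓ)) (trans (adj-sym ℓ p) e) ⟩
    nbrSum G (flip p a) ℓ xor true         ≡⟨ cong (_xor true) (nbrSum-isolated (flip p a) iso) ⟩
    true                                   ∎
    where
    open ≡-Reasoning
    identity : ∀ s e → s ≡ (s xor e) xor e
    identity = toWitness {a? = ∀Bool? λ s → ∀Bool? λ e → _ Bool.≟ _} _
    iso : Isolated (flip p a) ℓ
    iso on′ e′ = let s≢p , on″ = off-flip-on a on′ on in s≢p (leaf on″ e′)

  components-none : ∀ a {k} → (∀ i → ¬ On G a i) → HasComponents G a k → k ≡ 0
  components-none a {zero}  off _              = refl
  components-none a {suc _} off (_ , surj , _) with surj zero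
  ... | i , on , _ = contradiction on (off i)

  private
    euler-none : ∀ a {k} → (∀ i → ¬ On G a i) → HasComponents G a k → odd k ≡ q a
    euler-none a off h = trans (cong odd (components-none a off h))
                             (sym (quad-off (allFin n) a λ i → ≢true⇒≡false (off i)))

    euler-isolated : ∀ a {ℓ} → On G a ℓ → Isolated a ℓ →
      (∀ {k} → HasComponents G (flip ℓ a) k → odd k ≡ q (flip ℓ a)) →
      ∀ {k} → HasComponents G a k → odd k ≡ q a
    euler-isolated a {ℓ} on iso ih {zero}  (c , _) = case c ℓ on of λ ()
    euler-isolated a {ℓ} on iso ih {suc k} h       = begin
      not (odd k)                          ≡⟨ cong not (ih (components-isolated a on iso h)) ⟩
      not (q (flip ℓ a))                   ≡⟨ cong not (q-flip ℓ a) ⟩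
      not (not (q a xor nbrSum G a ℓ))     ≡⟨ cong (λ s → not (not (q a xor s))) (nbrSum-isolated a iso) ⟩
      not (not (q a xor false))            ≡⟨ Bool.not-involutive _ ⟩
      q a xor false                        ≡⟨ Bool.xor-identityʳ (q a) ⟩
      q a                                  ∎
      where open ≡-Reasoning

  supported-leaf : ∀ {S ℓ p} a → (∀ {s} → s ∈ S → Adj G s ℓ → s ≡ p) → SupportedOn (ℓ ∷ S) a →
    ∀ {s} → On G a s → Adj G s ℓ → s ≡ p
  supported-leaf a u supp {s} on e with supp s on
  ... | here refl = contradiction refl (adj⇒≢ e)
  ... | there s∈S = u s∈S e

  -- Vertices minus edges equals components in a forest, read modulo 2. Remove the newest vertex `ℓ`
  -- if it is labelled: with `p` unlabelled, one vertex and one component disappear; with `p`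
  -- labelled, one vertex and one edge disappear and the number of components stays.
  euler : ∀ {v S} → Grown (v ∷ []) S → ∀ a {k} → SupportedOn S a → HasComponents G a k → odd k ≡ q a
  euler {v} base a {k} supp h with lookup a v in av
  ... | false = euler-none a (λ i on → case supported-shrink a supp av i on of λ ()) h
  ... | true  = euler-isolated a av iso (euler-none (flip v a) λ i on → case supported-flip a supp av i on of λ ()) h
    where
    iso : Isolated a v
    iso {s} on e with supp s on
    ... | here refl = contradiction refl (adj⇒≢ e)
  euler (grow {S} {ℓ} {p} g p∈S e ℓ∉S u) a {k} supp h with lookup a ℓ in aℓ
  ... | false = euler g a (supported-shrink a supp aℓ) h
  ... | true with lookup a p in ap
  ...   | false = euler-isolated a aℓ
    (λ on e′ → case trans (sym on) (trans (cong (lookup a) (supported-leaf a u supp on e′)) ap) of λ ())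
    (euler g (flip ℓ a) (supported-flip a supp aℓ)) h
  ...   | true = begin
    odd k                       ≡⟨ euler g (flip ℓ a) (supported-flip a supp aℓ)
                                     (components-attached a aℓ ap e (supported-leaf a u supp) h) ⟩
    q (flip ℓ a)                ≡⟨ q-flip ℓ a ⟩
    not (q a xor nbrSum G a ℓ)  ≡⟨ cong (λ s → not (q a xor s)) (nbrSum-leaf a ap e (supported-leaf a u supp)) ⟩
    not (q a xor true)          ≡⟨ cong not (Bool.xor-comm (q a) true) ⟩
    not (not (q a))             ≡⟨ Bool.not-involutive (q a) ⟩
    q a                         ∎
    where open ≡-Reasoning

-- Finite checks on E₆

-- The vertices are t₂, t₁, u, s₂, s₁, v: the branch vertex v carries the arms s₁ t₁, s₂ t₂ and u.
E6 : SimpleGraph 6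
E6 = record
  { adj     = edge
  ; adj-sym = from-yes (all? λ i → all? λ j → edge i j Bool.≟ edge j i)
  ; irrefl  = from-yes (all? λ i → edge i i Bool.≟ false)
  }
  where
  edge : Fin 6 → Fin 6 → Bool
  edge i j = lookup (lookup
    ( (false ∷ false ∷ false ∷ true  ∷ false ∷ false ∷ [])
    ∷ (false ∷ false ∷ false ∷ false ∷ true  ∷ false ∷ [])
    ∷ (false ∷ false ∷ false ∷ false ∷ false ∷ true  ∷ [])
    ∷ (true  ∷ false ∷ false ∷ false ∷ false ∷ true  ∷ [])
    ∷ (false ∷ true  ∷ false ∷ false ∷ false ∷ true  ∷ [])
    ∷ (false ∷ false ∷ true  ∷ true  ∷ true  ∷ false ∷ [])
    ∷ []) i) j

module E6 = SimpleGraph E6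

-- Forces every map from E₆ that preserves edges and non-edges to be injective.
E6-rows-distinct : ∀ i j → (∀ k → E6.adj i k ≡ E6.adj j k) → i ≡ j
E6-rows-distinct = from-yes (all? λ i → all? λ j →
  (all? λ k → E6.adj i k Bool.≟ E6.adj j k) →-dec (i ≟ j))

-- For a vector of neighbour sums this says that some move at these vertices changes the labeling.
Awake : ∀ {m} → Vec Bool m → Set
Awake v = ∃ λ j → lookup v j ≡ true

awake? : ∀ {m} → Decidable (Awake {m})
awake? v = any? λ j → lookup v j Bool.≟ true

module _ {X : Set} (act : Fin 6 → X → X) (Goal : X → Set) where

  -- The run may stop after any prefix, so one word can serve all starting states.
  data Reaches : List (Fin 6) → X → Set where
    stop : ∀ {w x} → Goal x → Reaches w x
    next : ∀ {j w x} → Reaches w (act j x) → Reaches (j ∷ w) x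

  reaches? : Decidable Goal → ∀ w → Decidable (Reaches w)
  reaches? goal? []      x = map′ stop (λ { (stop g) → g }) (goal? x)
  reaches? goal? (j ∷ w) x =
    map′ (λ { (inj₁ g) → stop g ; (inj₂ r) → next r }) (λ { (stop g) → inj₁ g ; (next r) → inj₂ r })
      (goal? x ⊎-dec reaches? goal? w (act j x))

-- Found by a computer search: from each nonzero state of the two systems below, the moves
-- along this word pass through a goal.
word : List (Fin 6)
word =
  1F ∷ 0F ∷ 4F ∷ 2F ∷ 3F ∷ 5F ∷ 0F ∷ 3F ∷ 4F ∷ 1F ∷ 2F ∷ 5F ∷ 4F ∷ 2F ∷ 5F ∷ 1F ∷ 3F ∷ 0F ∷ 3F ∷ 4F ∷
  2F ∷ 5F ∷ 2F ∷ 1F ∷ 3F ∷ 4F ∷ 5F ∷ 0F ∷ 4F ∷ 1F ∷ 4F ∷ 2F ∷ 5F ∷ 3F ∷ 0F ∷ 0F ∷ 5F ∷ 3F ∷ 4F ∷ 1F ∷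
  4F ∷ 2F ∷ 0F ∷ 3F ∷ 5F ∷ 3F ∷ 4F ∷ 5F ∷ 2F ∷ 3F ∷ 0F ∷ 3F ∷ 4F ∷ 4F ∷ 5F ∷ 4F ∷ 2F ∷ 4F ∷ 2F ∷ 0F ∷
  1F ∷ 3F ∷ 4F ∷ 5F ∷ 4F ∷ 2F ∷ 0F ∷ 3F ∷ 0F ∷ 4F ∷ 5F ∷ 3F ∷ 0F ∷ 5F ∷ 3F ∷ 0F ∷ 5F ∷ 4F ∷ 5F ∷ 1F ∷
  4F ∷ []

-- The branch vertex alone has one component; the tips `t₂` and `t₁` of the two long arms form two.
oddRep evenRep : Vec Bool 6
oddRep  = false ∷ false ∷ false ∷ false ∷ false ∷ true ∷ []
evenRep = true ∷ true ∷ false ∷ false ∷ false ∷ false ∷ []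

IsRep : Vec Bool 6 → Set
IsRep w = w ≡ oddRep ⊎ w ≡ evenRep

isRep? : Decidable IsRep
isRep? w = ≡-dec Bool._≟_ w oddRep ⊎-dec ≡-dec Bool._≟_ w evenRep

abstract
  -- All 64 labelings are checked by evaluation; `abstract` keeps the search from being unfolded
  -- later.
  E6-reaches-rep : ∀ w → (∃ λ j → nbrSum E6 w j ≡ true) → Reaches (T E6) IsRep word w
  E6-reaches-rep = from-yes (∀Vec? λ w →
    (any? λ j → nbrSum E6 w j Bool.≟ true) →-dec reaches? (T E6) IsRep isRep? word w)

-- A state (s , m) records the neighbour sums s of the six vertices and the neighbour sum m of a
-- further vertex whose only neighbour among the six is i.
turn : Fin 6 → Fin 6 → Vec Bool 6 × Bool → Vec Bool 6 × Bool
turn i j (s , m) =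
  tabulate (λ k → lookup s k xor (lookup s j ∧ E6.adj k j)) , m xor (lookup s j ∧ ⌊ i ≟ j ⌋)

-- The move at the further vertex acts, and the sums are still nonzero after it has flipped the one
-- at `i`.
Ready : Fin 6 → Vec Bool 6 × Bool → Set
Ready i (s , m) = m ≡ true × Awake (flip i s)

ready? : ∀ i → Decidable (Ready i)
ready? i (s , m) = (m Bool.≟ true) ×-dec awake? (flip i s)

abstract
  E6-reaches-ready : ∀ i m s → Awake s → Reaches (turn i) (Ready i) word (s , m)
  E6-reaches-ready = from-yes (all? λ i → ∀Bool? λ m → ∀Vec? λ s →
    awake? s →-dec reaches? (turn i) (Ready i) (ready? i) word (s , m))

-- Moves at an embedded E₆ and clearing the labels outside it

module _ {n : ℕ} (G : SimpleGraph n) where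
  open SimpleGraph G
  open DecMembership (_≟_ {n}) using (_∈?_)

  Awakens : Labeling G → Fin n → Set
  Awakens a v = ∃ λ b → _∼_ G a b × nbrSum G b v ≡ true

  -- Moving at i changes the neighbour sum of every neighbour of i.
  spread : ∀ {P i v} a → WalkIn G P i v → nbrSum G a i ≡ true → Awakens a v
  spread a (here _) h = a , ε , h
  spread {i = i} a (step {j = j} _ e w) h with nbrSum G a j in aj
  ... | true  = spread a w aj
  ... | false =
    let b , r , h′ = spread (T G i a) w moved in b , (i , refl) ◅ r , h′
    where
    moved : nbrSum G (T G i a) j ≡ true
    moved rewrite nbrSum-T G i a j | aj | h = trans (adj-sym j i) e

  module _ (W : Fin 6 → Fin n) (W-adj : ∀ i j → adj (W i) (W j) ≡ E6.adj i j) where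

    W-injective : ∀ {i j} → W i ≡ W j → i ≡ j
    W-injective {i} {j} eq = E6-rows-distinct i j λ k →
      trans (sym (W-adj i k)) (trans (cong (λ x → adj x (W k)) eq) (W-adj j k))

    core : List (Fin n)
    core = List.map W (allFin 6)

    W∈core : ∀ i → W i ∈ core
    W∈core i = ∈-map⁺ W (∈-allFin i)

    core-unique : Unique core
    core-unique = Unique.map⁺ W-injective (Unique.allFin⁺ 6)

    sums : Labeling G → Vec Bool 6
    sums a = tabulate (nbrSum G a ∘ W)

    lookup-sums : ∀ a k → lookup (sums a) k ≡ nbrSum G a (W k)
    lookup-sums a = lookup∘tabulate (nbrSum G a ∘ W)

    agreeOff-T : ∀ a b j → AgreeOff core a b → AgreeOff core a (T G (W j) b)
    agreeOff-T a b j off s s∉ = trans (lookup-T-≢ G (λ { refl → s∉ (W∈core j) }) b) (off s s∉)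

    -- Lifts a run of the system `act` to moves in the graph, along a map `σ` that intertwines the
    -- two. Intertwining is asked only where the labels off the core are those of `a₀`, because
    -- `restriction` commutes with moves once these labels are known to vanish.
    follow : ∀ {X : Set} (act : Fin 6 → X → X) (Goal : X → Set) (σ : Labeling G → X) a₀ →
      (∀ j b → AgreeOff core a₀ b → σ (T G (W j) b) ≡ act j (σ b)) →
      ∀ {w} b → AgreeOff core a₀ b → Reaches act Goal w (σ b) →
      ∃ λ c → _∼_ G b c × AgreeOff core a₀ c × Goal (σ c)
    follow act Goal σ a₀ comm b off (stop g) = b , ε , off , g
    follow act Goal σ a₀ comm b off (next {j} {w} r) =
      let c , b∼c , off′ , g = follow act Goal σ a₀ comm (T G (W j) b) (agreeOff-T a₀ b j off)
                                 (subst (Reaches act Goal w) (sym (comm j b off)) r)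
      in c , (W j , refl) ◅ b∼c , off′ , g

    sums-T : ∀ j a → sums (T G (W j) a) ≡
      tabulate (λ k → lookup (sums a) k xor (lookup (sums a) j ∧ E6.adj k j))
    sums-T j a = tabulate-cong λ k → trans (nbrSum-T G (W j) a (W k))
      (cong₂ _xor_ (sym (lookup-sums a k)) (cong₂ _∧_ (sym (lookup-sums a j)) (W-adj k j)))

    -- Other labels in `S` may change on the way. Keeping the core sums nonzero allows one toggle to
    -- follow another.
    Toggle : List (Fin n) → Fin n → Set
    Toggle S r = ∀ a → Awake (sums a) → ∃ λ b →
      _∼_ G a b × Awake (sums b) × lookup b r ≡ not (lookup a r) × AgreeOff S a b

    flip-sums : ∀ {i ℓ} → (∀ k → adj (W k) ℓ ≡ ⌊ i ≟ k ⌋) → ∀ a → Awake (flip i (sums a)) →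
      Awake (sums (flip ℓ a))
    flip-sums {i} {ℓ} att a (k , h) = k , (begin
      lookup (sums (flip ℓ a)) k            ≡⟨ lookup-sums (flip ℓ a) k ⟩
      nbrSum G (flip ℓ a) (W k)             ≡⟨ nbrSum-flip G ℓ a (W k) ⟩
      nbrSum G a (W k) xor adj (W k) ℓ      ≡⟨ cong₂ _xor_ (sym (lookup-sums a k)) (att k) ⟩
      lookup (sums a) k xor ⌊ i ≟ k ⌋       ≡⟨ flipped ⟨
      lookup (flip i (sums a)) k            ≡⟨ h ⟩
      true                                  ∎)
      where
      open ≡-Reasoning
      flipped : lookup (flip i (sums a)) k ≡ lookup (sums a) k xor ⌊ i ≟ k ⌋
      flipped with i ≟ k
      ... | yes refl = trans (lookup-flip i (sums a)) (Bool.xor-comm true _)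
      ... | no i≢k   = trans (lookup-flip-≢ (i≢k ∘ sym) (sums a)) (sym (Bool.xor-identityʳ _))

    -- Moves at the core raise the neighbour sum of `ℓ` to 1, in a state where the core sums survive
    -- the move at `ℓ`. They leave the label of `ℓ` alone, so only the final move flips it.
    toggle-attached : ∀ {i ℓ} → ℓ ∉ core → (∀ k → adj (W k) ℓ ≡ ⌊ i ≟ k ⌋) → Toggle (ℓ ∷ core) ℓ
    toggle-attached {i} {ℓ} ℓ∉ att a aw =
      let b , a∼b , off , m , aw′ = follow (turn i) (Ready i) (λ b → sums b , nbrSum G b ℓ) a comm a
                                      (λ _ _ → refl) (E6-reaches-ready i (nbrSum G a ℓ) (sums a) aw)
          b′ = T-active G ℓ b m
      in T G ℓ b , a∼b ◅◅ move G ℓ b ,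
         subst (Awake ∘ sums) (sym b′) (flip-sums att b aw′) ,
         trans (cong (λ c → lookup c ℓ) b′) (trans (lookup-flip ℓ b) (cong not (off ℓ ℓ∉))) ,
         λ s s∉ → trans (lookup-T-≢ G (λ { refl → s∉ (here refl) }) b) (off s (s∉ ∘ there))
      where
      comm : ∀ j b → AgreeOff core a b →
        (sums (T G (W j) b) , nbrSum G (T G (W j) b) ℓ) ≡ turn i j (sums b , nbrSum G b ℓ)
      comm j b _ = cong₂ _,_ (sums-T j b) (trans (nbrSum-T G (W j) b ℓ)
        (cong (nbrSum G b ℓ xor_) (cong₂ _∧_ (sym (lookup-sums b j)) (trans (adj-sym ℓ (W j)) (att j)))))

    core⊆grown : ∀ {S} → Grown G core S → ∀ {s} → s ∈ core → s ∈ S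
    core⊆grown base             s∈ = s∈
    core⊆grown (grow g _ _ _ _) s∈ = there (core⊆grown g s∈)

    -- Induction on the growth. If the parent `p` of `ℓ` is outside the core, then `ℓ` has no
    -- neighbour in the core and its move keeps the core sums. Should its neighbour sum be 0,
    -- toggling `p` makes it 1.
    toggle : ∀ {S r} → Grown G core S → r ∈ S → r ∉ core → Toggle S r
    toggle base r∈ r∉ = contradiction r∈ r∉
    toggle (grow g _ _ _ _) (there r∈) r∉ a aw =
      let b , a∼b , aw′ , fl , off = toggle g r∈ r∉ a aw
      in b , a∼b , aw′ , fl , λ s s∉ → off s (s∉ ∘ there)
    toggle (grow {S} {ℓ} {p} g p∈S e ℓ∉S u) (here refl) ℓ∉ a aw with p ∈? core
    ... | yes p∈ with ∈-map⁻ W p∈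
    ...   | i , _ , refl =
      let b , a∼b , aw′ , fl , off = toggle-attached ℓ∉ att a aw
      in b , a∼b , aw′ , fl , λ s s∉ → off s λ { (here refl) → s∉ (here refl)
                                               ; (there s∈) → s∉ (there (core⊆grown g s∈)) }
      where
      att : ∀ k → adj (W k) ℓ ≡ ⌊ i ≟ k ⌋
      att k with i ≟ k
      ... | yes refl = e
      ... | no i≢k   = ≢true⇒≡false λ e′ → i≢k (sym (W-injective (u (core⊆grown g (W∈core k)) e′)))
    toggle (grow {S} {ℓ} {p} g p∈S e ℓ∉S u) (here refl) ℓ∉ a aw | no p∉ = by (nbrSum G a ℓ) refl
      where
      detached : ∀ k → adj (W k) ℓ ≡ false
      detached k = ≢true⇒≡false λ e′ →
        p∉ (subst (_∈ core) (u (core⊆grown g (W∈core k)) e′) (W∈core k))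

      here-ready : ∀ b → nbrSum G b ℓ ≡ true → Awake (sums b) → AgreeOff S a b → ∃ λ c →
        _∼_ G b c × Awake (sums c) × lookup c ℓ ≡ not (lookup a ℓ) × AgreeOff (ℓ ∷ S) a c
      here-ready b h (k , hk) off = T G ℓ b , move G ℓ b , (k , (begin
          lookup (sums (T G ℓ b)) k                         ≡⟨ lookup-sums (T G ℓ b) k ⟩
          nbrSum G (T G ℓ b) (W k)                          ≡⟨ nbrSum-T G ℓ b (W k) ⟩
          nbrSum G b (W k) xor (nbrSum G b ℓ ∧ adj (W k) ℓ) ≡⟨ cong (λ x → nbrSum G b (W k) xor (nbrSum G b ℓ ∧ x)) (detached k) ⟩
          nbrSum G b (W k) xor (nbrSum G b ℓ ∧ false)       ≡⟨ cong (nbrSum G b (W k) xor_) (Bool.∧-zeroʳ _) ⟩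
          nbrSum G b (W k) xor false                        ≡⟨ Bool.xor-identityʳ _ ⟩
          nbrSum G b (W k)                                  ≡⟨ lookup-sums b k ⟨
          lookup (sums b) k                                 ≡⟨ hk ⟩
          true                                              ∎)) ,
        trans (cong (λ c → lookup c ℓ) (T-active G ℓ b h)) (trans (lookup-flip ℓ b) (cong not (off ℓ ℓ∉S))) ,
        λ s s∉ → trans (lookup-T-≢ G (λ { refl → s∉ (here refl) }) b) (off s (s∉ ∘ there))
        where open ≡-Reasoning

      by : ∀ m → nbrSum G a ℓ ≡ m → ∃ λ c →
        _∼_ G a c × Awake (sums c) × lookup c ℓ ≡ not (lookup a ℓ) × AgreeOff (ℓ ∷ S) a c
      by true  h = here-ready a h aw (λ _ _ → refl)
      by false h =
        let b , a∼b , aw′ , fl , off = toggle g p∈S p∉ a aw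
            c , b∼c , rest = here-ready b (flipped b fl off) aw′ off
        in c , a∼b ◅◅ b∼c , rest
        where
        flipped : ∀ b → lookup b p ≡ not (lookup a p) → AgreeOff S a b → nbrSum G b ℓ ≡ true
        flipped b fl off = begin
          nbrSum G b ℓ            ≡⟨ nbrSum-cong G b (flip p a) ℓ same ⟩
          nbrSum G (flip p a) ℓ   ≡⟨ nbrSum-flip G p a ℓ ⟩
          nbrSum G a ℓ xor adj ℓ p ≡⟨ cong₂ _xor_ h (trans (adj-sym ℓ p) e) ⟩
          true                    ∎
          where
          open ≡-Reasoning
          same : ∀ {k} → Adj G ℓ k → lookup b k ≡ lookup (flip p a) k
          same {k} ℓk with k ≟ p
          ... | yes refl = trans fl (sym (lookup-flip p a))
          -- Any other neighbour of `ℓ` lies outside `S`, where toggling `p` changed nothing.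
          ... | no k≢p   = trans (off k λ k∈S → k≢p (u k∈S (trans (adj-sym k ℓ) ℓk))) (sym (lookup-flip-≢ k≢p a))

    -- Toggling the newest vertex may disturb older ones but nothing beyond it, so vertices already
    -- cleared stay cleared.
    retract : ∀ {S} → Grown G core S → ∀ a → Awake (sums a) → SupportedOn S a → ∃ λ b →
      _∼_ G a b × Awake (sums b) × SupportedOn core b
    retract base a aw supp = a , ε , aw , supp
    retract (grow {S} {ℓ} g p∈S e ℓ∉S u) a aw supp with lookup a ℓ in aℓ
    ... | false = retract g a aw (supported-shrink a supp aℓ)
    ... | true  =
      let b , a∼b , aw′ , fl , off = toggle (grow g p∈S e ℓ∉S u) (here refl) (ℓ∉S ∘ core⊆grown g) a aw
          c , b∼c , rest = retract g b aw′
                             (supported-shrink b (agreeOff-supported a b off supp) (trans fl (cong not aℓ)))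
      in c , a∼b ◅◅ b∼c , rest

    restriction : Labeling G → Vec Bool 6
    restriction a = tabulate (lookup a ∘ W)

    lookup-restriction : ∀ a k → lookup (restriction a) k ≡ lookup a (W k)
    lookup-restriction a = lookup∘tabulate (lookup a ∘ W)

    nbrSum-restriction : ∀ a → SupportedOn core a → ∀ i → nbrSum G a (W i) ≡ nbrSum E6 (restriction a) i
    nbrSum-restriction a supp i = trans (nbrSum-supported G core-unique a supp (W i))
      (cong (List.foldr _xor_ false) (trans (sym (map-∘ {g = λ k → adj (W i) k ∧ lookup a k} {W} (allFin 6)))
        (map-cong (λ j → cong₂ _∧_ (W-adj i j) (sym (lookup-restriction a j))) (allFin 6))))

    restriction-T : ∀ j a → SupportedOn core a → restriction (T G (W j) a) ≡ T E6 j (restriction a)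
    restriction-T j a supp = lookup-ext λ k → trans (lookup-restriction (T G (W j) a) k) (pointwise k (k ≟ j))
      where
      open ≡-Reasoning
      pointwise : ∀ k → Dec (k ≡ j) → lookup (T G (W j) a) (W k) ≡ lookup (T E6 j (restriction a)) k
      pointwise k (yes refl) = begin
        lookup (T G (W k) a) (W k)                                       ≡⟨ lookup-T G (W k) a ⟩
        lookup a (W k) xor nbrSum G a (W k)                              ≡⟨ cong₂ _xor_ (sym (lookup-restriction a k)) (nbrSum-restriction a supp k) ⟩
        lookup (restriction a) k xor nbrSum E6 (restriction a) k         ≡⟨ lookup-T E6 k (restriction a) ⟨
        lookup (T E6 k (restriction a)) k                                ∎
      pointwise k (no k≢j) = begin
        lookup (T G (W j) a) (W k)        ≡⟨ lookup-T-≢ G (k≢j ∘ W-injective) a ⟩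
        lookup a (W k)                    ≡⟨ lookup-restriction a k ⟨
        lookup (restriction a) k          ≡⟨ lookup-T-≢ E6 k≢j (restriction a) ⟨
        lookup (T E6 j (restriction a)) k ∎

-- Independent sets and fixed labelings

module _ {n : ℕ} (G : SimpleGraph n) where
  open SimpleGraph G
  open DecMembership (_≟_ {n}) using (_∈?_)

  components-independent : ∀ {k} a (f : Fin k → Fin n) → (∀ {i j} → f i ≡ f j → i ≡ j) →
    (∀ i j → adj (f i) (f j) ≡ false) → (∀ i → On G a (f i)) → (∀ s → On G a s → ∃ λ i → f i ≡ s) →
    HasComponents G a k
  components-independent {k} a f inj indep f-on on-f =
    (λ s on → proj₁ (on-f s on)) ,
    (λ i → f i , f-on i , inj (proj₂ (on-f (f i) (f-on i)))) ,
    λ s t os ot → mk⇔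
      (λ eq → subst (WalkIn G (On G a) s)
                (trans (sym (proj₂ (on-f s os))) (trans (cong f eq) (proj₂ (on-f t ot)))) (here os))
      (λ w → inj (trans (proj₂ (on-f s os)) (trans (stuck w) (sym (proj₂ (on-f t ot))))))
    where
    stuck : ∀ {s t} → WalkIn G (On G a) s t → s ≡ t
    stuck (here _) = refl
    stuck (step os e w) with on-f _ os | on-f _ (walk-start G w)
    ... | i , refl | j , refl = case trans (sym e) (indep i j) of λ ()

  fixed-∼ : ∀ {a b} → Fixed G a → _∼_ G a b → a ≡ b
  fixed-∼ fix ε = refl
  fixed-∼ fix ((i , eq) ◅ ms) with trans (sym eq) (fix i)
  ... | refl = fixed-∼ fix ms

  nbrSum⇒¬fixed : ∀ a {i} → nbrSum G a i ≡ true → ¬ Fixed G a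
  nbrSum⇒¬fixed a {i} h fix = Bool.not-¬ {lookup a i} refl (begin
    lookup a i                  ≡⟨ cong (λ b → lookup b i) (fix i) ⟨
    lookup (T G i a) i          ≡⟨ cong (λ b → lookup b i) (T-active G i a h) ⟩
    lookup (flip i a) i         ≡⟨ lookup-flip i a ⟩
    not (lookup a i)            ∎)
    where open ≡-Reasoning

  ¬fixed⇒nbrSum : ∀ a → ¬ Fixed G a → ∃ λ i → nbrSum G a i ≡ true
  ¬fixed⇒nbrSum a ¬fix with ¬∀⟶∃¬ n _ (λ i → ≡-dec Bool._≟_ (T G i a) a) ¬fix
  ... | i , moves with T-cases G i a
  ... | inj₁ (h , _) = i , h
  ... | inj₂ (_ , e) = contradiction e moves

  -- Growing a tree from a subtree

  -- Unlike `WalkIn`, it exposes the list of visited vertices, both ends included, from which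
  -- `HasCycle` is built.
  data Path : Fin n → List (Fin n) → Fin n → Set where
    stay : ∀ {x} → Path x (x ∷ []) x
    _∷_  : ∀ {x y z xs} → Adj G x y → Path y xs z → Path x (x ∷ xs) z

  path-snoc : ∀ {x xs y z} → Path x xs y → Adj G y z → Path x (xs ++ [ z ]) z
  path-snoc stay    e = e ∷ stay
  path-snoc (f ∷ p) e = f ∷ path-snoc p e

  path-isWalkList : ∀ {w x xs y z} → Adj G w x → Path x xs y → Adj G y z → IsWalkList G (w ∷ xs ++ [ z ])
  path-isWalkList e stay    f = e , f , tt
  path-isWalkList e (g ∷ p) f = e , path-isWalkList g p f

  path-length : ∀ {x xs y} → Path x xs y → x ≢ y → 2 ≤ length xs
  path-length stay          x≢y = contradiction refl x≢y
  path-length (_ ∷ stay)    _   = s≤s (s≤s z≤n)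
  path-length (_ ∷ (_ ∷ _)) _   = s≤s (s≤s z≤n)

  ∉⇒All≢ : ∀ {ℓ : Fin n} {S xs} → ℓ ∉ S → All (_∈ S) xs → All (ℓ ≢_) xs
  ∉⇒All≢ ℓ∉ = All.map λ { x∈ refl → ℓ∉ x∈ }

  -- A new leaf lies outside `S`, so adding it at either end of a path in `S` creates no repetition.
  simple-path : ∀ {v S} → Grown G [ v ] S → ∀ {x y} → x ∈ S → y ∈ S →
    ∃ λ xs → Path x xs y × Unique xs × All (_∈ S) xs
  simple-path base (here refl) (here refl) = _ , stay , [] ∷ [] , here refl ∷ []
  simple-path (grow g p∈ e ℓ∉ _) (here refl) (here refl) = _ , stay , [] ∷ [] , here refl ∷ []
  simple-path (grow {ℓ = ℓ} {p} g p∈ e ℓ∉ _) (here refl) (there y∈) =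
    let _ , path , uniq , in-S = simple-path g p∈ y∈
    in _ , trans (adj-sym ℓ p) e ∷ path , ∉⇒All≢ ℓ∉ in-S ∷ uniq , here refl ∷ All.map there in-S
  simple-path (grow g p∈ e ℓ∉ _) (there x∈) (here refl) =
    let _ , path , uniq , in-S = simple-path g x∈ p∈
    in _ , path-snoc path e ,
       Unique.++⁺ uniq ([] ∷ []) (λ { (i∈ , here refl) → All¬⇒¬Any (∉⇒All≢ ℓ∉ in-S) i∈ }) ,
       ++⁺ (All.map there in-S) (here refl ∷ [])
  simple-path (grow g _ _ _ _) (there x∈) (there y∈) =
    let _ , path , uniq , in-S = simple-path g x∈ y∈ in _ , path , uniq , All.map there in-S

  triangle : ∀ {x y z} → Adj G x y → Adj G y z → Adj G z x → HasCycle G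
  triangle {x} {y} {z} e f g =
    x , y ∷ z ∷ [] , s≤s (s≤s z≤n) , (adj⇒≢ G e ∷ (adj⇒≢ G g ∘ sym) ∷ []) ∷ (adj⇒≢ G f ∷ []) ∷ [] ∷ [] , e , f , g , tt

  module _ (acyclic : ¬ HasCycle G) where

    -- A second neighbour `s` would close a cycle through `ℓ` and the simple path from `p` to `s`
    -- inside `S`.
    parent-unique : ∀ {v S} → Grown G [ v ] S → ∀ {p ℓ} → p ∈ S → Adj G p ℓ → ℓ ∉ S →
      ∀ {s} → s ∈ S → Adj G s ℓ → s ≡ p
    parent-unique g {p} {ℓ} p∈ e ℓ∉ {s} s∈ e′ with s ≟ p
    ... | yes eq  = eq
    ... | no  s≢p = contradiction
      (let xs , path , uniq , in-S = simple-path g p∈ s∈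
       in ℓ , xs , path-length path (s≢p ∘ sym) , ∉⇒All≢ ℓ∉ in-S ∷ uniq ,
          path-isWalkList (trans (adj-sym ℓ p) e) path e′)
      acyclic

    attach : ∀ {v S} → Grown G [ v ] S → ∀ {p ℓ} → p ∈ S → Adj G p ℓ → ℓ ∉ S → Grown G [ v ] (ℓ ∷ S)
    attach g p∈ e ℓ∉ = grow g p∈ e ℓ∉ (parent-unique g p∈ e ℓ∉)

    nonadjacent : ∀ {v S} → Grown G [ v ] S → ∀ {p ℓ} → p ∈ S → Adj G p ℓ → ℓ ∉ S →
      ∀ {s} → s ∈ S → s ≢ p → adj s ℓ ≡ false
    nonadjacent g p∈ e ℓ∉ s∈ s≢p = ≢true⇒≡false (s≢p ∘ parent-unique g p∈ e ℓ∉ s∈)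

    module _ {v C} (core-grown : Grown G [ v ] C) where

      -- Follow the walk and attach each new vertex to its predecessor, which has already been
      -- absorbed.
      absorb : ∀ {S i j} → Grown G C S → i ∈ S → WalkIn G (AnyVertex G) i j →
        ∃ λ S′ → Grown G C S′ × (∀ {s} → s ∈ S → s ∈ S′) × j ∈ S′
      absorb g i∈ (here _) = _ , g , id , i∈
      absorb {S} g i∈ (step {j = k} _ e w) with k ∈? S
      ... | yes k∈ = absorb g k∈ w
      ... | no k∉  =
        -- `parent-unique` speaks of growth from one vertex, so the growth of the core is put in
        -- front.
        let S′ , g′ , S⊆ , j∈ = absorb (grow g i∈ e k∉ (parent-unique (Grown-trans G core-grown g) i∈ e k∉))
                                  (here refl) w
        in S′ , g′ , S⊆ ∘ there , j∈

      absorb-all : Connected G → ∀ xs {S i} → Grown G C S → i ∈ S →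
        ∃ λ S′ → Grown G C S′ × (∀ {s} → s ∈ S → s ∈ S′) × All (_∈ S′) xs
      absorb-all conn []       g i∈ = _ , g , id , []
      absorb-all conn (x ∷ xs) g i∈ =
        let _ , g₁ , ⊆₁ , x∈ = absorb g i∈ (conn _ x)
            S′ , g₂ , ⊆₂ , all = absorb-all conn xs g₁ x∈
        in S′ , g₂ , ⊆₂ ∘ ⊆₁ , ⊆₂ x∈ ∷ all

      spanning : Connected G → ∀ {i} → i ∈ C → ∃ λ S → Grown G C S × (∀ s → s ∈ S)
      spanning conn i∈ =
        let S , g , _ , all = absorb-all conn (allFin n) base i∈
        in S , g , λ s → All.lookup all (∈-allFin s)

  -- Locating an induced E₆ in the tree

  record Core : Set where
    field
      W       : Fin 6 → Fin n
      W-adj   : ∀ i j → adj (W i) (W j) ≡ E6.adj i j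
      -- Makes every growth from the core a growth from the branch vertex, as `euler` requires.
      W-grown : Grown G [ W 5F ] (core G W W-adj)

  -- Cut the walk after its last visit to `v`, if there is one.
  exit : ∀ {v i x} → x ≢ v → WalkIn G (AnyVertex G) i x →
    WalkIn G (Avoid G v) i x ⊎ ∃ λ s → Adj G v s × WalkIn G (Avoid G v) s x
  exit x≢v (here _) = inj₁ (here x≢v)
  exit {v} x≢v (step {i} _ e w) with exit x≢v w | i ≟ v
  ... | inj₂ r | _        = inj₂ r
  ... | inj₁ r | yes refl = inj₂ (_ , e , r)
  ... | inj₁ r | no i≢v   = inj₁ (step i≢v e r)

  record Arm (v x : Fin n) : Set where
    field
      s t : Fin n
      vs  : Adj G v s
      st  : Adj G s t
      t≢v : t ≢ v
      s⇝x : WalkIn G (Avoid G v) s x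

  first-step : ∀ {v s z} → s ≢ z → WalkIn G (Avoid G v) s z → ∃ λ t → Adj G s t × t ≢ v
  first-step s≢z (here _)     = contradiction refl s≢z
  first-step s≢z (step _ e w) = _ , e , walk-start G w

  -- The walk from `v` to `x` leaves `v` for good through `s`. If `s` is not `x`, the next vertex
  -- towards `x` serves as `t`; otherwise the next one towards `y` does.
  arm : Connected G → ∀ {v x y} → x ≢ y → WalkIn G (Avoid G v) x y → Arm v x
  arm conn {v} {x} {y} x≢y x⇝y with exit (walk-start G x⇝y) (conn v x)
  ... | inj₁ v⇝x = contradiction refl (walk-start G v⇝x)
  ... | inj₂ (s , vs , s⇝x) =
    let t , st , t≢v = next-vertex in record { vs = vs ; st = st ; t≢v = t≢v ; s⇝x = s⇝x }
    where
    next-vertex : ∃ λ t → Adj G s t × t ≢ v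
    next-vertex with s ≟ x
    ... | no s≢x   = first-step s≢x s⇝x
    ... | yes refl = first-step x≢y x⇝y

  -- Pigeonhole: two vertices cannot exhaust three distinct neighbours.
  third-neighbour : ∀ {v u₁ u₂ u₃} → Adj G v u₁ → Adj G v u₂ → Adj G v u₃ →
    u₁ ≢ u₂ → u₁ ≢ u₃ → u₂ ≢ u₃ → ∀ s₁ s₂ → ∃ λ u → Adj G v u × u ≢ s₁ × u ≢ s₂
  third-neighbour {u₁ = u₁} {u₂} e₁ e₂ e₃ d₁₂ d₁₃ d₂₃ s₁ s₂ with u₁ ≟ s₁ | u₁ ≟ s₂
  ... | no a | no b = _ , e₁ , a , b
  ... | yes refl | _ with u₂ ≟ s₂
  ...   | no b     = _ , e₂ , d₁₂ ∘ sym , b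
  ...   | yes refl = _ , e₃ , d₁₃ ∘ sym , d₂₃ ∘ sym
  third-neighbour {u₁ = u₁} {u₂} e₁ e₂ e₃ d₁₂ d₁₃ d₂₃ s₁ s₂ | no _ | yes refl with u₂ ≟ s₁
  ...   | no b     = _ , e₂ , b , d₁₂ ∘ sym
  ...   | yes refl = _ , e₃ , d₂₃ ∘ sym , d₁₃ ∘ sym

  find-core : IsTree G → ContainsE6 G → Core
  find-core (conn , acyclic)
    (v , (_ , _ , _ , e₁ , e₂ , e₃ , d₁₂ , d₁₃ , d₂₃) ,
     x₁ , y₁ , x₂ , y₂ , x₁≢y₁ , x₂≢y₂ , x₁⇝y₁ , x₂⇝y₂ , apart) =
    record { W = W ; W-adj = W-adj ; W-grown = grown-t₂ }
    where
    open Arm (arm conn x₁≢y₁ x₁⇝y₁) renaming (s to s₁; t to t₁; vs to vs₁; st to st₁; t≢v to t₁≢v; s⇝x to s₁⇝x₁)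
    open Arm (arm conn x₂≢y₂ x₂⇝y₂) renaming (s to s₂; t to t₂; vs to vs₂; st to st₂; t≢v to t₂≢v; s⇝x to s₂⇝x₂)

    u : Fin n
    u = proj₁ (third-neighbour e₁ e₂ e₃ d₁₂ d₁₃ d₂₃ s₁ s₂)
    vu : Adj G v u
    vu = proj₁ (proj₂ (third-neighbour e₁ e₂ e₃ d₁₂ d₁₃ d₂₃ s₁ s₂))
    u≢s₁ : u ≢ s₁
    u≢s₁ = proj₁ (proj₂ (proj₂ (third-neighbour e₁ e₂ e₃ d₁₂ d₁₃ d₂₃ s₁ s₂)))
    u≢s₂ : u ≢ s₂
    u≢s₂ = proj₂ (proj₂ (proj₂ (third-neighbour e₁ e₂ e₃ d₁₂ d₁₃ d₂₃ s₁ s₂)))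

    v≢ : ∀ {s} → Adj G v s → s ≢ v
    v≢ e = adj⇒≢ G e ∘ sym

    separated : ¬ WalkIn G (Avoid G v) s₁ s₂
    separated w = apart (walk-trans G (walk-sym G s₁⇝x₁) (walk-trans G w s₂⇝x₂))

    back₂ : ∀ {z} → z ≡ t₂ → WalkIn G (Avoid G v) z s₂
    back₂ refl = step t₂≢v (trans (adj-sym t₂ s₂) st₂) (here (v≢ vs₂))

    -- A coincidence between the two arms would give a walk from `s₁` to `s₂` that avoids `v`.
    s₂≢s₁ : s₂ ≢ s₁
    s₂≢s₁ eq = separated (subst (WalkIn G (Avoid G v) s₁) (sym eq) (here (v≢ vs₁)))
    t₁≢s₂ : t₁ ≢ s₂
    t₁≢s₂ eq = separated (step (v≢ vs₁) st₁ (subst (λ z → WalkIn G (Avoid G v) z s₂) (sym eq) (here (v≢ vs₂))))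
    t₂≢s₁ : t₂ ≢ s₁
    t₂≢s₁ eq = separated (back₂ (sym eq))
    t₂≢t₁ : t₂ ≢ t₁
    t₂≢t₁ eq = separated (step (v≢ vs₁) st₁ (back₂ (sym eq)))
    -- A tip equal to `u` would be adjacent to `v` and close a triangle.
    t₁≢u : t₁ ≢ u
    t₁≢u eq = acyclic (triangle vs₁ st₁ (trans (adj-sym t₁ v) (subst (Adj G v) (sym eq) vu)))
    t₂≢u : t₂ ≢ u
    t₂≢u eq = acyclic (triangle vs₂ st₂ (trans (adj-sym t₂ v) (subst (Adj G v) (sym eq) vu)))

    s₁∉ : s₁ ∉ v ∷ []
    s₁∉ = All¬⇒¬Any (v≢ vs₁ ∷ [])
    grown-s₁ : Grown G [ v ] (s₁ ∷ v ∷ [])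
    grown-s₁ = attach acyclic base (here refl) vs₁ s₁∉

    s₂∉ : s₂ ∉ s₁ ∷ v ∷ []
    s₂∉ = All¬⇒¬Any (s₂≢s₁ ∷ v≢ vs₂ ∷ [])
    grown-s₂ : Grown G [ v ] (s₂ ∷ s₁ ∷ v ∷ [])
    grown-s₂ = attach acyclic grown-s₁ (there (here refl)) vs₂ s₂∉

    u∉ : u ∉ s₂ ∷ s₁ ∷ v ∷ []
    u∉ = All¬⇒¬Any (u≢s₂ ∷ u≢s₁ ∷ v≢ vu ∷ [])
    grown-u : Grown G [ v ] (u ∷ s₂ ∷ s₁ ∷ v ∷ [])
    grown-u = attach acyclic grown-s₂ (there (there (here refl))) vu u∉

    t₁∉ : t₁ ∉ u ∷ s₂ ∷ s₁ ∷ v ∷ []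
    t₁∉ = All¬⇒¬Any (t₁≢u ∷ t₁≢s₂ ∷ adj⇒≢ G st₁ ∘ sym ∷ t₁≢v ∷ [])
    grown-t₁ : Grown G [ v ] (t₁ ∷ u ∷ s₂ ∷ s₁ ∷ v ∷ [])
    grown-t₁ = attach acyclic grown-u (there (there (here refl))) st₁ t₁∉

    t₂∉ : t₂ ∉ t₁ ∷ u ∷ s₂ ∷ s₁ ∷ v ∷ []
    t₂∉ = All¬⇒¬Any (t₂≢t₁ ∷ t₂≢u ∷ adj⇒≢ G st₂ ∘ sym ∷ t₂≢s₁ ∷ t₂≢v ∷ [])
    grown-t₂ : Grown G [ v ] (t₂ ∷ t₁ ∷ u ∷ s₂ ∷ s₁ ∷ v ∷ [])
    grown-t₂ = attach acyclic grown-t₁ (there (there (here refl))) st₂ t₂∉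

    -- Newest vertex first, so that `core` computes to the list of `grown-t₂`.
    W : Fin 6 → Fin n
    W = lookup (t₂ ∷ t₁ ∷ u ∷ s₂ ∷ s₁ ∷ v ∷ [])

    -- Non-edges come from the growth: each vertex has only its parent as a neighbour among the
    -- older ones.
    apart-s₂ : ∀ {s} → s ∈ s₁ ∷ v ∷ [] → s ≢ v → adj s₂ s ≡ false
    apart-s₂ {s} s∈ s≢ = trans (adj-sym s₂ s) (nonadjacent acyclic grown-s₁ (there (here refl)) vs₂ s₂∉ s∈ s≢)

    apart-u : ∀ {s} → s ∈ s₂ ∷ s₁ ∷ v ∷ [] → s ≢ v → adj u s ≡ false
    apart-u {s} s∈ s≢ = trans (adj-sym u s) (nonadjacent acyclic grown-s₂ (there (there (here refl))) vu u∉ s∈ s≢)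

    apart-t₁ : ∀ {s} → s ∈ u ∷ s₂ ∷ s₁ ∷ v ∷ [] → s ≢ s₁ → adj t₁ s ≡ false
    apart-t₁ {s} s∈ s≢ = trans (adj-sym t₁ s) (nonadjacent acyclic grown-u (there (there (here refl))) st₁ t₁∉ s∈ s≢)

    apart-t₂ : ∀ {s} → s ∈ t₁ ∷ u ∷ s₂ ∷ s₁ ∷ v ∷ [] → s ≢ s₂ → adj t₂ s ≡ false
    apart-t₂ {s} s∈ s≢ = trans (adj-sym t₂ s) (nonadjacent acyclic grown-t₁ (there (there (here refl))) st₂ t₂∉ s∈ s≢)

    upper : ∀ i j → i < j → adj (W i) (W j) ≡ E6.adj i j
    upper 0F 1F _ = apart-t₂ (here refl) t₁≢s₂
    upper 0F 2F _ = apart-t₂ (there (here refl)) u≢s₂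
    upper 0F 3F _ = trans (adj-sym t₂ s₂) st₂
    upper 0F 4F _ = apart-t₂ (there (there (there (here refl)))) (s₂≢s₁ ∘ sym)
    upper 0F 5F _ = apart-t₂ (there (there (there (there (here refl))))) (adj⇒≢ G vs₂)
    upper 1F 2F _ = apart-t₁ (here refl) u≢s₁
    upper 1F 3F _ = apart-t₁ (there (here refl)) s₂≢s₁
    upper 1F 4F _ = trans (adj-sym t₁ s₁) st₁
    upper 1F 5F _ = apart-t₁ (there (there (there (here refl)))) (adj⇒≢ G vs₁)
    upper 2F 3F _ = apart-u (here refl) (v≢ vs₂)
    upper 2F 4F _ = apart-u (there (here refl)) (v≢ vs₁)
    upper 2F 5F _ = trans (adj-sym u v) vu
    upper 3F 4F _ = apart-s₂ (here refl) (v≢ vs₁)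
    upper 3F 5F _ = trans (adj-sym s₂ v) vs₂
    upper 4F 5F _ = trans (adj-sym s₁ v) vs₁
    upper 1F 1F (s≤s ())
    upper 2F 1F (s≤s ())
    upper 2F 2F (s≤s (s≤s ()))
    upper 3F 1F (s≤s ())
    upper 3F 2F (s≤s (s≤s ()))
    upper 3F 3F (s≤s (s≤s (s≤s ())))
    upper (suc (suc (suc (suc _)))) 1F (s≤s ())
    upper (suc (suc (suc (suc _)))) 2F (s≤s (s≤s ()))
    upper (suc (suc (suc (suc _)))) 3F (s≤s (s≤s (s≤s ())))
    upper (suc (suc (suc (suc _)))) 4F (s≤s (s≤s (s≤s (s≤s ()))))
    upper (suc (suc (suc (suc (suc _))))) 5F (s≤s (s≤s (s≤s (s≤s (s≤s ())))))

    W-adj : ∀ i j → adj (W i) (W j) ≡ E6.adj i j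
    W-adj i j with <-cmp i j
    ... | tri< i<j _ _    = upper i j i<j
    ... | tri≈ _ refl _   = trans (irrefl (W i)) (sym (E6.irrefl i))
    ... | tri> _ _ j<i    = trans (adj-sym (W i) (W j)) (trans (upper j i j<i) (E6.adj-sym j i))

  -- Representatives and the classification of non-fixed labelings

  module _ (C : Core) where
    open Core C

    private
      K : List (Fin n)
      K = core G W W-adj

    -- The decision is an argument so that proofs about `embed` can split on it. Vertices outside
    -- the core get label 0.
    extend : Vec Bool 6 → ∀ {s} → Dec (∃ λ i → W i ≡ s) → Bool
    extend w (yes (i , _)) = lookup w i
    extend w (no _)        = false

    embed : Vec Bool 6 → Labeling G
    embed w = tabulate λ s → extend w (any? λ i → W i ≟ s)

    embed-supported : ∀ w → SupportedOn K (embed w)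
    embed-supported w s on with any? (λ i → W i ≟ s) | trans (sym (lookup∘tabulate _ s)) on
    ... | yes (i , refl) | _ = W∈core G W W-adj i
    ... | no _           | ()

    embed-restriction : ∀ w → restriction G W W-adj (embed w) ≡ w
    embed-restriction w = lookup-ext λ k →
      trans (lookup-restriction G W W-adj (embed w) k) (trans (lookup∘tabulate _ (W k)) (at k))
      where
      at : ∀ k → extend w (any? λ i → W i ≟ W k) ≡ lookup w k
      at k with any? (λ i → W i ≟ W k)
      ... | yes (i , eq) = cong (lookup w) (W-injective G W W-adj eq)
      ... | no ∄         = contradiction (k , refl) ∄

    restriction-injective : ∀ a b → SupportedOn K a → SupportedOn K b →
      restriction G W W-adj a ≡ restriction G W W-adj b → a ≡ b
    restriction-injective a b sa sb eq = lookup-ext pointwise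
      where
      pointwise : ∀ s → lookup a s ≡ lookup b s
      pointwise s with s ∈? K
      ... | no s∉ = trans (≢true⇒≡false (s∉ ∘ sa s)) (sym (≢true⇒≡false (s∉ ∘ sb s)))
      ... | yes s∈ with ∈-map⁻ W s∈
      ...   | k , _ , refl = trans (sym (lookup-restriction G W W-adj a k))
                (trans (cong (λ w → lookup w k) eq) (lookup-restriction G W W-adj b k))

    -- `g` lists the labelled vertices of an independent set in E₆; it stays independent in the
    -- graph because `W` preserves non-edges.
    components-restriction : ∀ {k w} (g : Fin k → Fin 6) → (∀ i j → g i ≡ g j → i ≡ j) →
      (∀ i j → E6.adj (g i) (g j) ≡ false) → (∀ i → lookup w (g i) ≡ true) →
      (∀ j → lookup w j ≡ true → ∃ λ i → g i ≡ j) →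
      ∀ a → SupportedOn K a → restriction G W W-adj a ≡ w → HasComponents G a k
    components-restriction {w = w} g inj indep g-on on-g a supp refl =
      components-independent a (W ∘ g) (λ eq → inj _ _ (W-injective G W W-adj eq))
        (λ i j → trans (W-adj (g i) (g j)) (indep i j))
        (λ i → trans (sym (lookup-restriction G W W-adj a (g i))) (g-on i))
        on⇒
      where
      on⇒ : ∀ s → On G a s → ∃ λ i → W (g i) ≡ s
      on⇒ s on with ∈-map⁻ W (supp s on)
      ... | j , _ , refl =
        let i , eq = on-g j (trans (lookup-restriction G W W-adj a j) on) in i , cong W eq

    oddRep-components : ∀ a → SupportedOn K a → restriction G W W-adj a ≡ oddRep → HasComponents G a 1
    oddRep-components = components-restriction {1} {oddRep} g
      (from-yes (all? λ i → all? λ j → (g i ≟ g j) →-dec (i ≟ j)))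
      (from-yes (all? λ i → all? λ j → E6.adj (g i) (g j) Bool.≟ false))
      (from-yes (all? λ i → lookup oddRep (g i) Bool.≟ true))
      (from-yes (all? λ j → (lookup oddRep j Bool.≟ true) →-dec any? λ i → g i ≟ j))
      where
      g : Fin 1 → Fin 6
      g _ = 5F

    evenRep-components : ∀ a → SupportedOn K a → restriction G W W-adj a ≡ evenRep → HasComponents G a 2
    evenRep-components = components-restriction {2} {evenRep} g
      (from-yes (all? λ i → all? λ j → (g i ≟ g j) →-dec (i ≟ j)))
      (from-yes (all? λ i → all? λ j → E6.adj (g i) (g j) Bool.≟ false))
      (from-yes (all? λ i → lookup evenRep (g i) Bool.≟ true))
      (from-yes (all? λ j → (lookup evenRep j Bool.≟ true) →-dec any? λ i → g i ≟ j))
      where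
      g : Fin 2 → Fin 6
      g = lookup (0F ∷ 1F ∷ [])

    embed-¬fixed : ∀ w i → nbrSum E6 w i ≡ true → ¬ Fixed G (embed w)
    embed-¬fixed w i h = nbrSum⇒¬fixed (embed w) {W i}
      (trans (nbrSum-restriction G W W-adj (embed w) (embed-supported w) i)
        (trans (cong (λ w → nbrSum E6 w i) (embed-restriction w)) h))

    module _ (conn : Connected G) {S} (S-grown : Grown G K S) (S-all : ∀ s → s ∈ S) where

      to-rep : ∀ a → ¬ Fixed G a → ∃ λ b → _∼_ G a b × SupportedOn K b × IsRep (restriction G W W-adj b)
      to-rep a ¬fix =
        let i , h            = ¬fixed⇒nbrSum a ¬fix
            b , a∼b , hb     = spread G a (conn i (W 5F)) h
            c , b∼c , aw , s = retract G W W-adj S-grown b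
                                 (5F , trans (lookup-sums G W W-adj b 5F) hb) (λ s _ → S-all s)
            d , c∼d , s′ , r = finish c aw s
        in d , a∼b ◅◅ b∼c ◅◅ c∼d , s′ , r
        where
        finish : ∀ c → Awake (sums G W W-adj c) → SupportedOn K c → ∃ λ d →
          _∼_ G c d × SupportedOn K d × IsRep (restriction G W W-adj d)
        -- Moves at the core create no label outside it, so `restriction` keeps commuting with them.
        finish c (k , h) supp =
          let d , c∼d , off , r = follow G W W-adj (T E6) IsRep (restriction G W W-adj) c
                (λ j b off → restriction-T G W W-adj j b (agreeOff-supported c b off supp)) c (λ _ _ → refl)
                (E6-reaches-rep (restriction G W W-adj c)
                  (k , trans (sym (nbrSum-restriction G W W-adj c supp k))
                         (trans (sym (lookup-sums G W W-adj c k)) h)))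
          in d , c∼d , agreeOff-supported c d off supp , r

      full-grown : Grown G [ W 5F ] S
      full-grown = Grown-trans G W-grown S-grown

      parity : ∀ a {k} → HasComponents G a k → odd k ≡ q G a
      parity a = euler G full-grown a (λ s _ → S-all s)

      -- Both labelings reduce to representatives. Those have one or two components, so equal `q`
      -- forces the same one, and the second reduction is then reversed.
      q-injective : ∀ a b → ¬ Fixed G a → ¬ Fixed G b → q G a ≡ q G b → _∼_ G a b
      q-injective a b ¬fa ¬fb eq =
        let c , a∼c , sc , rc = to-rep a ¬fa
            d , b∼d , sd , rd = to-rep b ¬fb
            c≡d = same c d sc sd rc rd (trans (sym (q-∼ G a∼c)) (trans eq (q-∼ G b∼d)))
        in a∼c ◅◅ subst (λ x → _∼_ G x b) (sym c≡d) (∼-sym G b∼d)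
        where
        same : ∀ c d → SupportedOn K c → SupportedOn K d →
          IsRep (restriction G W W-adj c) → IsRep (restriction G W W-adj d) → q G c ≡ q G d → c ≡ d
        same c d sc sd (inj₁ ec) (inj₁ ed) _ = restriction-injective c d sc sd (trans ec (sym ed))
        same c d sc sd (inj₂ ec) (inj₂ ed) _ = restriction-injective c d sc sd (trans ec (sym ed))
        same c d sc sd (inj₁ ec) (inj₂ ed) eq =
          case trans (parity c (oddRep-components c sc ec)) (trans eq (sym (parity d (evenRep-components d sd ed)))) of λ ()
        same c d sc sd (inj₂ ec) (inj₁ ed) eq =
          case trans (parity c (evenRep-components c sc ec)) (trans eq (sym (parity d (oddRep-components d sd ed)))) of λ ()

      classes : ∀ a b k m → ¬ Fixed G a → ¬ Fixed G b → HasComponents G a k → HasComponents G b m →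
        (_∼_ G a b ⇔ k % 2 ≡ m % 2)
      classes a b k m ¬fa ¬fb ha hb = mk⇔
        (λ a∼b → trans (%2-odd k) (trans (cong bit (trans (parity a ha) (trans (q-∼ G a∼b) (sym (parity b hb)))))
                   (sym (%2-odd m))))
        (λ eq → q-injective a b ¬fa ¬fb (trans (sym (parity a ha))
                  (trans (bit-injective (trans (sym (%2-odd k)) (trans eq (%2-odd m)))) (parity b hb))))

theorem3p1 : (n : ℕ) (G : SimpleGraph n) → IsTree G → ContainsE6 G →
    (∀ a b → Fixed G a → (_∼_ G a b ⇔ a ≡ b))
    × (∀ a b k m → ¬ Fixed G a → ¬ Fixed G b → HasComponents G a k → HasComponents G b m →
    (_∼_ G a b ⇔ k % 2 ≡ m % 2))
    × (Σ (Labeling G) λ a → Σ ℕ λ k → ¬ Fixed G a × HasComponents G a k × k % 2 ≡ 1)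
    × (Σ (Labeling G) λ a → Σ ℕ λ k → ¬ Fixed G a × HasComponents G a k × k % 2 ≡ 0)
theorem3p1 n G tree e6 =
  (λ a b fix → mk⇔ (fixed-∼ G fix) (λ { refl → ε })) ,
  (let S , S-grown , S-all = spanning G (proj₂ tree) W-grown (proj₁ tree) (W∈core G W W-adj 5F)
   in classes G C (proj₁ tree) S-grown S-all) ,
  -- `2F` is `u`, whose only labelled neighbour is the branch vertex.
  (embed G C oddRep , 1 , embed-¬fixed G C oddRep 2F refl ,
   oddRep-components G C (embed G C oddRep) (embed-supported G C oddRep) (embed-restriction G C oddRep) , refl) ,
  -- `3F` is `s₂`, whose only labelled neighbour is `t₂`.
  (embed G C evenRep , 2 , embed-¬fixed G C evenRep 3F refl ,
   evenRep-components G C (embed G C evenRep) (embed-supported G C evenRep) (embed-restriction G C evenRep) , refl)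
  where
  C : Core G
  C = find-core G tree e6
  open Core C
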